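{- Let $x$ be a positive integer. (a) If $x\equiv 1$ or $4\pmod 8$, then there are no integers $y$ and $n\ge 2$ with $T_1(x)=y^n$. (b) If $x\equiv 4$ or $5\pmod 8$, then there are no integers $k,y,n$ with $k\ge 2$ even, $n\ge 2$ and $T_k(x)=y^n$.
   Context: For positive integers $x,k$, $T_k(x)=(x+1)^k+(x+2)^k+\cdots+(2x)^k$. -}

module Defs where

open import Data.Nat using (ℕ; suc; _+_; _^_)
open import Data.List using (map; upTo)
open import Data.Nat.ListAction using (sum)

-- upTo x = 0, …, x - 1, so the bases run over x + 1, …, x + x = 2x.
T : ℕ → ℕ → ℕ
T k x = sum (map (λ i → (x + suc i) ^ k) (upTo x))

{-# OPTIONS --safe #-}
-- Under each congruence condition the sum is ≡ 2 (mod 4), whereas a perfect power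
-- divisible by 2 is divisible by 4.  The residue of T k x modulo 4 depends only on
-- x mod 8 and on the residues a ^ k mod 4, and for even k ≥ 2 the latter agree with
-- a ^ 2, so it suffices to evaluate T 1 1, T 1 4, T 2 4 and T 2 5.
module Submission where

open import Data.Nat using (ℕ; _≤_; _<_; _%_)
open import Data.Nat.Divisibility using (_∣_)
open import Data.Integer using (ℤ; +_; _^_)
open import Data.Product using (_×_; Σ-syntax)
open import Data.Sum using (_⊎_)
open import Relation.Nullary using (¬_)
open import Relation.Binary.PropositionalEquality using (_≡_)
open import Defs

open import Data.Nat using (zero; suc; s≤s; _+_; _*_; _/_; NonZero)
import Data.Nat as ℕ
open import Data.Nat.DivMod
open import Data.Nat.Divisibility
  using (divides; ∣-trans; m∣m*n; *-pres-∣; m%n≡0⇒n∣m; n∣m⇒m%n≡0; ∣1⇒≡1)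
open import Data.Nat.ListAction using (sum)
open import Data.Nat.Primality using (Prime; euclidsLemma; prime[2]; ¬prime[1])
open import Data.Nat.Properties using (+-assoc; +-comm; *-assoc; *-comm; *-identityʳ; ^-*-assoc)
open import Data.Nat.Tactic.RingSolver using (solve-∀)
open import Data.Integer using (∣_∣)
open import Data.Integer.Properties using (abs-*)
open import Data.List using (applyUpTo)
open import Data.List.Properties using (map-upTo)
open import Data.Product using (_,_)
open import Data.Sum using (inj₁; inj₂; [_,_]′)
open import Function using (id)
open import Relation.Nullary using (contradiction)
open import Relation.Binary.PropositionalEquality
  using (refl; sym; trans; cong; cong₂; subst; module ≡-Reasoning)
open ≡-Reasoning

module _ (d : ℕ) .{{_ : NonZero d}} where

  +-cong-% : ∀ {a b u v} → a % d ≡ b % d → u % d ≡ v % d → (a + u) % d ≡ (b + v) % d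
  +-cong-% {a} {b} {u} {v} p q = begin
    (a + u) % d          ≡⟨ %-distribˡ-+ a u d ⟩
    (a % d + u % d) % d  ≡⟨ cong₂ (λ s t → (s + t) % d) p q ⟩
    (b % d + v % d) % d  ≡⟨ %-distribˡ-+ b v d ⟨
    (b + v) % d          ∎

  *-cong-% : ∀ {a b u v} → a % d ≡ b % d → u % d ≡ v % d → (a * u) % d ≡ (b * v) % d
  *-cong-% {a} {b} {u} {v} p q = begin
    (a * u) % d            ≡⟨ %-distribˡ-* a u d ⟩
    (a % d * (u % d)) % d  ≡⟨ cong₂ (λ s t → (s * t) % d) p q ⟩
    (b % d * (v % d)) % d  ≡⟨ %-distribˡ-* b v d ⟨
    (b * v) % d            ∎

  ^-cong-% : ∀ k a b → a % d ≡ b % d → (a ℕ.^ k) % d ≡ (b ℕ.^ k) % d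
  ^-cong-% zero    a b p = refl
  ^-cong-% (suc k) a b p = *-cong-% {a} {b} p (^-cong-% k a b p)

  -- An idempotent residue absorbs each further factor of itself. The exponent is `suc q` because
  -- the zeroth power is 1.
  idempotent-^-% : ∀ {c} → (c * c) % d ≡ c % d → ∀ q → (c ℕ.^ suc q) % d ≡ c % d
  idempotent-^-% {c} idem zero    = cong (_% d) (*-identityʳ c)
  idempotent-^-% {c} idem (suc q) = trans (*-cong-% {c} refl (idempotent-^-% idem q)) idem

  sum-cong-% : ∀ {f g} → (∀ i → f i % d ≡ g i % d) →
    ∀ n → sum (applyUpTo f n) % d ≡ sum (applyUpTo g n) % d
  sum-cong-% p zero    = refl
  sum-cong-% p (suc n) = +-cong-% (p 0) (sum-cong-% (λ i → p (suc i)) n)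

  sum-applyUpTo-+ : ∀ (f : ℕ → ℕ) p n →
    sum (applyUpTo f (p + n)) ≡ sum (applyUpTo f p) + sum (applyUpTo (λ i → f (p + i)) n)
  sum-applyUpTo-+ f zero    n = refl
  sum-applyUpTo-+ f (suc p) n = begin
    f 0 + sum (applyUpTo (λ i → f (suc i)) (p + n))
      ≡⟨ cong (λ s → f 0 + s) (sum-applyUpTo-+ (λ i → f (suc i)) p n) ⟩
    f 0 + (sum (applyUpTo (λ i → f (suc i)) p) + sum (applyUpTo (λ i → f (suc (p + i))) n))
      ≡⟨ +-assoc (f 0) (sum (applyUpTo (λ i → f (suc i)) p)) _ ⟨
    f 0 + sum (applyUpTo (λ i → f (suc i)) p) + sum (applyUpTo (λ i → f (suc (p + i))) n) ∎

  -- Induction on `m`: the first block vanishes, and by periodicity the remaining terms may be read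
  -- as starting from index 0 again.
  sum-periodic-% : ∀ {f} p → (∀ i → f (p + i) % d ≡ f i % d) → sum (applyUpTo f p) % d ≡ 0 % d →
    ∀ m r → sum (applyUpTo f (m * p + r)) % d ≡ sum (applyUpTo f r) % d
  sum-periodic-% {f} p per block zero    r = refl
  sum-periodic-% {f} p per block (suc m) r = begin
    sum (applyUpTo f (p + m * p + r)) % d
      ≡⟨ cong (λ n → sum (applyUpTo f n) % d) (+-assoc p (m * p) r) ⟩
    sum (applyUpTo f (p + (m * p + r))) % d
      ≡⟨ cong (_% d) (sum-applyUpTo-+ f p (m * p + r)) ⟩
    (sum (applyUpTo f p) + sum (applyUpTo (λ i → f (p + i)) (m * p + r))) % d
      -- `block` puts 0 in place of the first summand, and `0 + v` reduces to `v`.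
      ≡⟨ +-cong-% block (sum-cong-% per (m * p + r)) ⟩
    sum (applyUpTo f (m * p + r)) % d
      ≡⟨ sum-periodic-% p per block m r ⟩
    sum (applyUpTo f r) % d ∎

T≡sum-applyUpTo : ∀ k x → T k x ≡ sum (applyUpTo (λ i → (x + suc i) ℕ.^ k) x)
T≡sum-applyUpTo k x = cong sum (map-upTo (λ i → (x + suc i) ℕ.^ k) x)

-- Here `x` enters twice. As a shift of the bases it matters only modulo 4, so it becomes `r`; as
-- the number of terms it matters modulo 8. Although the terms have period 4, four consecutive ones
-- sum to 2 modulo 4 when `e` is 1 or 2, so only a double period vanishes.
T-cong-% : ∀ k e → (∀ a → (a ℕ.^ k) % 4 ≡ (a ℕ.^ e) % 4) →
  ∀ r → sum (applyUpTo (λ i → (r + suc i) ℕ.^ e) 8) % 4 ≡ 0 →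
  ∀ m → T k (m * 8 + r) % 4 ≡ T e r % 4
T-cong-% k e k~e r block m = begin
  T k x % 4
    ≡⟨ cong (_% 4) (T≡sum-applyUpTo k x) ⟩
  sum (applyUpTo (λ i → (x + suc i) ℕ.^ k) x) % 4
    ≡⟨ sum-cong-% 4 (λ i → trans (k~e (x + suc i)) (^-cong-% 4 e (x + suc i) (r + suc i) (base i))) x ⟩
  sum (applyUpTo (λ i → (r + suc i) ℕ.^ e) x) % 4
    ≡⟨ sum-periodic-% 4 8 (λ i → ^-cong-% 4 e (r + suc (8 + i)) (r + suc i) (shift i)) block m r ⟩
  sum (applyUpTo (λ i → (r + suc i) ℕ.^ e) r) % 4
    ≡⟨ cong (_% 4) (T≡sum-applyUpTo e r) ⟨
  T e r % 4 ∎
  where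
  x : ℕ
  x = m * 8 + r

  base-≡ : ∀ m r i → m * 8 + r + suc i ≡ r + suc i + m * 2 * 4
  base-≡ = solve-∀

  shift-≡ : ∀ r i → r + suc (8 + i) ≡ r + suc i + 2 * 4
  shift-≡ = solve-∀

  base : ∀ i → (x + suc i) % 4 ≡ (r + suc i) % 4
  base i = trans (cong (_% 4) (base-≡ m r i)) ([m+kn]%n≡m%n (r + suc i) (m * 2) 4)

  shift : ∀ i → (r + suc (8 + i)) % 4 ≡ (r + suc i) % 4
  shift i = trans (cong (_% 4) (shift-≡ r i)) ([m+kn]%n≡m%n (r + suc i) 2 4)

-- Squares are 0 or 1 modulo 4, and both residues are idempotent.
square-idempotent-%4 : ∀ a → (a ℕ.^ 2 * a ℕ.^ 2) % 4 ≡ (a ℕ.^ 2) % 4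
square-idempotent-%4 a = begin
  (a ℕ.^ 2 * a ℕ.^ 2) % 4              ≡⟨ *-cong-% 4 {a ℕ.^ 2} {(a % 4) ℕ.^ 2} a²~ a²~ ⟩
  ((a % 4) ℕ.^ 2 * (a % 4) ℕ.^ 2) % 4  ≡⟨ residue (a % 4) (m%n<n a 4) ⟩
  ((a % 4) ℕ.^ 2) % 4                  ≡⟨ a²~ ⟨
  (a ℕ.^ 2) % 4                        ∎
  where
  a²~ : (a ℕ.^ 2) % 4 ≡ ((a % 4) ℕ.^ 2) % 4
  a²~ = ^-cong-% 4 2 a (a % 4) (sym (m%n%n≡m%n a 4))

  residue : ∀ b → b < 4 → (b ℕ.^ 2 * b ℕ.^ 2) % 4 ≡ (b ℕ.^ 2) % 4
  residue 0 _ = refl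
  residue 1 _ = refl
  residue 2 _ = refl
  residue 3 _ = refl
  residue (suc (suc (suc (suc _)))) (s≤s (s≤s (s≤s (s≤s ()))))

even-^-%4 : ∀ {k} → 2 ≤ k → 2 ∣ k → ∀ a → (a ℕ.^ k) % 4 ≡ (a ℕ.^ 2) % 4
-- Exponent 0 must be excluded: for even `a` it gives 1, whereas `a ^ 2` gives 0.
even-^-%4 () (divides zero refl)
even-^-%4 _ (divides (suc q) refl) a = begin
  (a ℕ.^ (suc q * 2)) % 4    ≡⟨ cong (λ n → (a ℕ.^ n) % 4) (*-comm (suc q) 2) ⟩
  (a ℕ.^ (2 * suc q)) % 4    ≡⟨ cong (_% 4) (^-*-assoc a 2 (suc q)) ⟨
  ((a ℕ.^ 2) ℕ.^ suc q) % 4  ≡⟨ idempotent-^-% 4 {a ℕ.^ 2} (square-idempotent-%4 a) q ⟩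
  (a ℕ.^ 2) % 4              ∎

prime∣^⇒∣ : ∀ {p} → Prime p → ∀ y n → p ∣ y ℕ.^ n → p ∣ y
prime∣^⇒∣ pr y zero    p∣1 = contradiction (subst Prime (∣1⇒≡1 p∣1) pr) ¬prime[1]
prime∣^⇒∣ pr y (suc n) p∣  = [ id , prime∣^⇒∣ pr y n ]′ (euclidsLemma y (y ℕ.^ n) pr p∣)

-- By primality `p` divides `y`, and an exponent of at least 2 leaves `y * y` as a factor of the
-- power.
prime∣^⇒p²∣^ : ∀ {p} → Prime p → ∀ y {n} → 2 ≤ n → p ∣ y ℕ.^ n → p * p ∣ y ℕ.^ n
prime∣^⇒p²∣^ pr y {suc (suc n)} (s≤s (s≤s _)) p∣ =
  ∣-trans (*-pres-∣ p∣y p∣y) (subst (y * y ∣_) (*-assoc y y (y ℕ.^ n)) (m∣m*n (y ℕ.^ n)))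
  where p∣y = prime∣^⇒∣ pr y (suc (suc n)) p∣

abs-^ : ∀ y n → ∣ y ^ n ∣ ≡ ∣ y ∣ ℕ.^ n
abs-^ y zero    = refl
abs-^ y (suc n) = trans (abs-* y (y ^ n)) (cong (∣ y ∣ *_) (abs-^ y n))

-- Absolute values turn the equation into one over the naturals, which covers negative `y`. Then `t`
-- is even, hence divisible by 4.
%4≡2⇒not-power : ∀ {t} → t % 4 ≡ 2 → ∀ (y : ℤ) {n} → 2 ≤ n → ¬ (+ t ≡ y ^ n)
%4≡2⇒not-power {t} t%4≡2 y {n} 2≤n t≡yⁿ = contradiction (trans (sym t%4≡2) t%4≡0) λ ()
  where
  t≡ : t ≡ ∣ y ∣ ℕ.^ n
  t≡ = trans (cong ∣_∣ t≡yⁿ) (abs-^ y n)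

  2∣t : 2 ∣ t
  -- As 2 divides 4, the residue modulo 2 can be read off from the one modulo 4.
  2∣t = m%n≡0⇒n∣m t 2 (trans (sym (m∣n⇒o%n%m≡o%m 2 4 t (divides 2 refl))) (cong (_% 2) t%4≡2))

  t%4≡0 : t % 4 ≡ 0
  t%4≡0 = n∣m⇒m%n≡0 t 4
    (subst (4 ∣_) (sym t≡) (prime∣^⇒p²∣^ prime[2] ∣ y ∣ 2≤n (subst (2 ∣_) t≡ 2∣t)))

m≡[m/n]*n+r : ∀ m n {r} .{{_ : NonZero n}} → m % n ≡ r → m ≡ m / n * n + r
m≡[m/n]*n+r m n refl = trans (m≡m%n+[m/n]*n m n) (+-comm (m % n) (m / n * n))

T-%4 : ∀ k e → (∀ a → (a ℕ.^ k) % 4 ≡ (a ℕ.^ e) % 4) →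
  ∀ x r → x % 8 ≡ r → sum (applyUpTo (λ i → (r + suc i) ℕ.^ e) 8) % 4 ≡ 0 →
  T k x % 4 ≡ T e r % 4
T-%4 k e k~e x r x%8≡r block =
  trans (cong (λ z → T k z % 4) (m≡[m/n]*n+r x 8 x%8≡r)) (T-cong-% k e k~e r block (x / 8))

theorem2p2 : (x : ℕ) → 0 < x →
    ((x % 8 ≡ 1 ⊎ x % 8 ≡ 4) →
    ¬ (Σ[ y ∈ ℤ ] Σ[ n ∈ ℕ ] (2 ≤ n × + T 1 x ≡ y ^ n)))
    ×
    ((x % 8 ≡ 4 ⊎ x % 8 ≡ 5) →
    ¬ (Σ[ k ∈ ℕ ] Σ[ y ∈ ℤ ] Σ[ n ∈ ℕ ] (2 ≤ k × 2 ∣ k × 2 ≤ n × + T k x ≡ y ^ n)))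
theorem2p2 x _ =
  (λ h (y , n , 2≤n , eq) → %4≡2⇒not-power {T 1 x} (T1%4≡2 h) y 2≤n eq) ,
  (λ h (k , y , n , 2≤k , 2∣k , 2≤n , eq) →
    %4≡2⇒not-power {T k x} (Tk%4≡2 k (even-^-%4 2≤k 2∣k) h) y 2≤n eq)
  where
  T1%4≡2 : x % 8 ≡ 1 ⊎ x % 8 ≡ 4 → T 1 x % 4 ≡ 2
  -- With a literal `r`, `refl` settles the block sum, and `T 1 1` = 2 and `T 1 4` = 26 evaluate to
  -- residue 2.
  T1%4≡2 (inj₁ h) = T-%4 1 1 (λ _ → refl) x 1 h refl
  T1%4≡2 (inj₂ h) = T-%4 1 1 (λ _ → refl) x 4 h refl

  Tk%4≡2 : ∀ k → (∀ a → (a ℕ.^ k) % 4 ≡ (a ℕ.^ 2) % 4) →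
    x % 8 ≡ 4 ⊎ x % 8 ≡ 5 → T k x % 4 ≡ 2
  -- Likewise `T 2 4` = 174 and `T 2 5` = 330, both 2 modulo 4.
  Tk%4≡2 k k~2 (inj₁ h) = T-%4 k 2 k~2 x 4 h refl
  Tk%4≡2 k k~2 (inj₂ h) = T-%4 k 2 k~2 x 5 h refl
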